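{- Let $T$ be any finite set of non-negative integers containing $0$ and let $r = \max T$. Let $K_{m_1,m_2,\ldots,m_k}$ be the complete $k$-partite graph with partite sets $m_1, m_2, \ldots, m_k$, where $|m_i|$ denotes the number of vertices in the $i$-th partite set. Then, with respect to $T$, $$\lambda_{t,1}(K_{m_1,m_2,\ldots,m_k}) \le rk + \sum_{i=1}^{k} |m_i| - 1.$$
   Context: $d(u,v)$ denotes the distance between vertices $u$ and $v$ of a graph. Graphs are finite, simple, connected and undirected. For a finite set $T$ of non-negative integers containing $0$, an $L(t,1)$-colouring of a graph $G$ (with respect to $T$) is an assignment $c$ of non-negative integers to the vertices of $G$ such that $|c(u)-c(v)| \notin T$ whenever $d(u,v)=1$, and $c(u) \neq c(v)$ whenever $d(u,v)=2$. The $L(t,1)$-span of $G$ (with respect to $T$) is $\lambda_{t,1}(G) = \min_c \max_{u,v \in V(G)} |c(u)-c(v)|$, the minimum being over all $L(t,1)$-colourings $c$ of $G$; equivalently, it is the minimum over all such colourings of the highest colour used. -}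

module Defs where

open import Data.Fin using (Fin; zero; suc; toℕ; fromℕ<; finToFun; funToFin)
open import Data.Fin.Properties as Fin
  using (toℕ-injective; toℕ≤pred[n]; toℕ-fromℕ<; finToFun-funToFin; +↔⊎)
open import Data.List using (List; map; allFin; cartesianProductWith)
open import Data.List.Extrema.Nat using (max; max≤v⁺; xs≤max; argmax-sel)
open import Data.List.Membership.Propositional using (_∈_; _∉_)
open import Data.List.Membership.Propositional.Properties
  using (∈-map⁺; ∈-map⁻; ∈-allFin; ∈-cartesianProductWith⁺; ∈-cartesianProductWith⁻)
open import Data.List.Membership.DecPropositional using () renaming (_∈?_ to member?)
import Data.List.Relation.Unary.All as All
open import Data.Nat
  using (ℕ; zero; suc; _+_; _*_; _∸_; _^_; _≤_; _<_; z≤n; s≤s; ∣_-_∣)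
open import Data.Nat.Induction using (<-rec)
open import Data.Nat.Properties
open import Data.Product using (Σ; ∃; _×_; _,_; proj₁; proj₂)
open import Data.Sum using (_⊎_; inj₁; inj₂)
open import Data.Sum.Function.Propositional using (_⊎-↔_)
open import Data.Vec using (Vec; []; _∷_; lookup; sum)
open import Function using (_∘_; _↔_; Inverse; mk↔ₛ′)
open import Function.Properties.Inverse using (↔-refl; ↔-sym; ↔-trans)
open import Relation.Binary using (Symmetric; Irreflexive)
open import Relation.Binary.PropositionalEquality
open import Relation.Nullary using (Dec; yes; no)
open import Relation.Nullary.Decidable using (map′; _×-dec_; _→-dec_; ¬?)
open import Relation.Unary using (Decidable)

-- Finite simple undirected graphs.  Connectedness is not a field: distance is
-- the relation `Distance` below, which relates vertices in different
-- components to no number, so it makes sense without it.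
record Graph : Set₁ where
  field
    Vertex     : Set
    order      : ℕ
    finite     : Vertex ↔ Fin order
    Adj        : Vertex → Vertex → Set
    adj?       : ∀ u v → Dec (Adj u v)
    sym-adj    : Symmetric Adj
    irrefl-adj : Irreflexive _≡_ Adj

  index : Vertex → Fin order
  index = Inverse.to finite

  vertex : Fin order → Vertex
  vertex = Inverse.from finite

  vertices : List Vertex
  vertices = map vertex (allFin order)

  data Walk : Vertex → Vertex → ℕ → Set where
    []  : ∀ {u} → Walk u u 0
    _∷_ : ∀ {u v w n} → Adj u v → Walk v w n → Walk u w (suc n)

  -- `Distance u v n` is d(u,v) = n.
  Distance : Vertex → Vertex → ℕ → Set
  Distance u v n = Walk u v n × (∀ m → Walk u v m → n ≤ m)

open Graph using (Vertex)

module _ (T : List ℕ) (G : Graph) where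
  open Graph G hiding (Vertex)

  IsColouring : (Vertex G → ℕ) → Set
  IsColouring c = ∀ u v →
    (Distance u v 1 → ∣ c u - c v ∣ ∉ T) × (Distance u v 2 → c u ≢ c v)

  -- max over u, v of |c(u) - c(v)|; the base value 0 only matters for the
  -- empty graph, since u = v already contributes 0.
  spread : (Vertex G → ℕ) → ℕ
  spread c = max 0 (cartesianProductWith (λ u v → ∣ c u - c v ∣) vertices vertices)

  IsSpan : ℕ → Set
  IsSpan n = (∃ λ c → IsColouring c × spread c ≡ n)
           × (∀ c → IsColouring c → n ≤ spread c)

least : ∀ {P : ℕ → Set} → Decidable P → ∀ n → P n →
        ∃ λ m → P m × (∀ k → P k → m ≤ k)
least {P} P? = <-rec _ step
  where
  step : ∀ n → (∀ {m} → m < n → P m → ∃ λ l → P l × (∀ k → P k → l ≤ k)) →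
         P n → ∃ λ l → P l × (∀ k → P k → l ≤ k)
  step n rec pn with anyUpTo? P? n
  ... | yes (m , m<n , pm) = rec m<n pm
  ... | no none = n , pn , λ k pk → ≮⇒≥ (λ k<n → none (k , k<n , pk))

-- The minimum defining the span exists: some colouring exists, and whether
-- one of spread at most n exists is decidable, because such a colouring can be
-- translated to take values in {0, …, n}.
module _ (G : Graph) where
  open Graph G hiding (Vertex)

  vertex-index : ∀ v → vertex (index v) ≡ v
  vertex-index = Inverse.strictlyInverseʳ finite

  index-injective : ∀ {u v} → index u ≡ index v → u ≡ v
  index-injective {u} {v} e =
    trans (sym (vertex-index u)) (trans (cong vertex e) (vertex-index v))

  ∈-vertices : ∀ v → v ∈ vertices
  ∈-vertices v = subst (_∈ vertices) (vertex-index v) (∈-map⁺ vertex (∈-allFin (index v)))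

  _≟ᵥ_ : ∀ (u v : Vertex G) → Dec (u ≡ v)
  u ≟ᵥ v = map′ index-injective (cong index) (index u Fin.≟ index v)

  anyVertex? : ∀ {P : Vertex G → Set} → Decidable P → Dec (∃ P)
  anyVertex? {P} P? = map′ (λ (i , p) → vertex i , p)
    (λ (v , p) → index v , subst P (sym (vertex-index v)) p) (Fin.any? (P? ∘ vertex))

  allVertex? : ∀ {P : Vertex G → Set} → Decidable P → Dec (∀ v → P v)
  allVertex? {P} P? = map′ (λ f v → subst P (vertex-index v) (f (index v)))
    (λ f → f ∘ vertex) (Fin.all? (P? ∘ vertex))

  walk? : ∀ n u v → Dec (Walk u v n)
  walk? zero u v = map′ (λ { refl → [] }) (λ { [] → refl }) (u ≟ᵥ v)
  walk? (suc n) u v = map′ (λ (_ , a , p) → a ∷ p) (λ { (a ∷ p) → _ , a , p })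
    (anyVertex? (λ w → adj? u w ×-dec walk? n w v))

  distance? : ∀ u v n → Dec (Distance u v n)
  distance? u v n = walk? n u v ×-dec
    map′ (λ none m p → ≮⇒≥ (λ m<n → none (m , m<n , p)))
         (λ f (m , m<n , p) → <⇒≱ m<n (f m p))
         (¬? (anyUpTo? (λ m → walk? m u v) n))

  distance⇒≢ : ∀ {u v n} → Distance u v (suc n) → u ≢ v
  distance⇒≢ (_ , shortest) refl = n≮0 (shortest 0 [])

module _ (T : List ℕ) (G : Graph) where
  open Graph G hiding (Vertex)

  isColouring? : Decidable (IsColouring T G)
  isColouring? c = allVertex? G λ u → allVertex? G λ v →
    (distance? G u v 1 →-dec ¬? (member? _≟_ ∣ c u - c v ∣ T))
      ×-dec (distance? G u v 2 →-dec ¬? (c u ≟ c v))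

  isColouring-resp : ∀ {c c′} → (∀ u v → ∣ c u - c v ∣ ≡ ∣ c′ u - c′ v ∣) →
                     IsColouring T G c → IsColouring T G c′
  isColouring-resp {c} {c′} e h u v =
    (λ d → subst (_∉ T) (e u v) (proj₁ (h u v) d)) ,
    (λ d c′u≡c′v → proj₂ (h u v) d
      (∣m-n∣≡0⇒m≡n (trans (e u v) (m≡n⇒∣m-n∣≡0 c′u≡c′v))))

  difference≤spread : ∀ c u v → ∣ c u - c v ∣ ≤ spread T G c
  difference≤spread c u v = All.lookup (xs≤max 0 _)
    (∈-cartesianProductWith⁺ (λ u v → ∣ c u - c v ∣) (∈-vertices G u) (∈-vertices G v))

  spread≤ : ∀ c {n} → (∀ u v → ∣ c u - c v ∣ ≤ n) → spread T G c ≤ n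
  spread≤ c {n} h = max≤v⁺ z≤n (All.tabulate λ x∈ → bound (∈-cartesianProductWith⁻ _ vertices vertices x∈))
    where
    bound : ∀ {x} → (∃ λ u → ∃ λ v → u ∈ vertices × v ∈ vertices × x ≡ ∣ c u - c v ∣) → x ≤ n
    bound (u , v , _ , _ , refl) = h u v

  someColouring : ∃ (IsColouring T G)
  someColouring = c , λ u v →
    (λ d diff∈T → <⇒≱ (large (distance⇒≢ G d)) (All.lookup (xs≤max 0 T) diff∈T)) ,
    (λ d e → n≮0 (subst (max 0 T <_) (m≡n⇒∣m-n∣≡0 e) (large (distance⇒≢ G d))))
    where
    c : Vertex G → ℕ
    c v = toℕ (index v) * suc (max 0 T)

    large : ∀ {u v} → u ≢ v → max 0 T < ∣ c u - c v ∣
    large {u} {v} u≢v = begin-strict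
      max 0 T               <⟨ n<1+n _ ⟩
      suc (max 0 T)         ≡⟨ *-identityˡ _ ⟨
      1 * suc (max 0 T)     ≤⟨ *-monoˡ-≤ _ (n≢0⇒n>0 (u≢v ∘ index-injective G ∘ toℕ-injective ∘ ∣m-n∣≡0⇒m≡n)) ⟩
      ∣ toℕ (index u) - toℕ (index v) ∣ * suc (max 0 T)
                            ≡⟨ *-distribʳ-∣-∣ (suc (max 0 T)) (toℕ (index u)) (toℕ (index v)) ⟩
      ∣ c u - c v ∣         ∎
      where open ≤-Reasoning

  HasColouringOfSpread≤ : ℕ → Set
  HasColouringOfSpread≤ n = ∃ λ c → IsColouring T G c × spread T G c ≤ n

  normalise : ∀ {n} → HasColouringOfSpread≤ n →
              ∃ λ c → IsColouring T G c × (∀ v → c v ≤ n)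
  normalise {n} (c , col , sp) = c′ , isColouring-resp same col , small
    where
    open ≤-Reasoning
    top a : ℕ
    top = max 0 (map c vertices)
    a = top ∸ n

    c≤top : ∀ v → c v ≤ top
    c≤top v = All.lookup (xs≤max 0 _) (∈-map⁺ c (∈-vertices G v))

    top≤ : ∀ v → top ≤ n + c v
    top≤ v with argmax-sel (λ x → x) 0 (map c vertices)
    ... | inj₁ e = subst (_≤ n + c v) (sym e) z≤n
    ... | inj₂ m with ∈-map⁻ c m
    ...   | (w , _ , e) = begin
      top                  ≡⟨ e ⟩
      c w                  ≤⟨ m≤n+∣m-n∣ (c w) (c v) ⟩
      c v + ∣ c w - c v ∣  ≤⟨ +-monoʳ-≤ (c v) (≤-trans (difference≤spread c w v) sp) ⟩
      c v + n              ≡⟨ +-comm (c v) n ⟩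
      n + c v              ∎

    a≤ : ∀ v → a ≤ c v
    a≤ v = m≤n+o⇒m∸n≤o top n (top≤ v)

    c′ : Vertex G → ℕ
    c′ v = c v ∸ a

    same : ∀ u v → ∣ c u - c v ∣ ≡ ∣ c′ u - c′ v ∣
    same u v = trans (sym (cong₂ ∣_-_∣ (m+[n∸m]≡n (a≤ u)) (m+[n∸m]≡n (a≤ v))))
                     (∣m+n-m+o∣≡∣n-o∣ a (c′ u) (c′ v))

    small : ∀ v → c′ v ≤ n
    small v = m≤n+o⇒m∸n≤o (c v) a
      (≤-trans (c≤top v) (subst (top ≤_) (+-comm n a) (m≤n+m∸n top n)))

  hasColouringOfSpread≤? : Decidable HasColouringOfSpread≤
  hasColouringOfSpread≤? n = map′ from to
    (Fin.any? {n = suc n ^ order} (λ k → isColouring? (decode k)))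
    where
    decode : Fin (suc n ^ order) → Vertex G → ℕ
    decode k v = toℕ (finToFun {suc n} {order} k (index v))

    from : ∃ (IsColouring T G ∘ decode) → HasColouringOfSpread≤ n
    from (k , col) = decode k , col , spread≤ (decode k) λ u v →
      ≤-trans (∣m-n∣≤m⊔n (decode k u) (decode k v))
              (⊔-lub (toℕ≤pred[n] (finToFun {suc n} {order} k (index u)))
                     (toℕ≤pred[n] (finToFun {suc n} {order} k (index v))))

    to : HasColouringOfSpread≤ n → ∃ (IsColouring T G ∘ decode)
    to h with normalise h
    ... | (c , col , small) = k , isColouring-resp (λ u v → cong₂ ∣_-_∣ (e u) (e v)) col
      where
      f : Fin order → Fin (suc n)
      f i = fromℕ< (s≤s (small (vertex i)))

      k : Fin (suc n ^ order)
      k = funToFin f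

      e : ∀ v → c v ≡ decode k v
      e v = sym (trans (cong toℕ (finToFun-funToFin f (index v)))
                (trans (toℕ-fromℕ< _) (cong c (vertex-index G v))))

  span-exists : ∃ (IsSpan T G)
  span-exists with someColouring
  ... | (c₀ , col₀) with least hasColouringOfSpread≤? (spread T G c₀) (c₀ , col₀ , ≤-refl)
  ...   | (n , (c , col , sp) , min) =
    n , (c , col , ≤-antisym sp (min _ (c , col , ≤-refl)))
      , λ c′ col′ → min _ (c′ , col′ , ≤-refl)

  span : ℕ
  span = proj₁ span-exists

  span-isSpan : IsSpan T G span
  span-isSpan = proj₂ span-exists

PartiteVertex : ∀ {k} → Vec ℕ k → Set
PartiteVertex {k} m = Σ (Fin k) (λ i → Fin (lookup m i))

partite-finite : ∀ {k} (m : Vec ℕ k) → PartiteVertex m ↔ Fin (sum m)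
partite-finite [] = mk↔ₛ′ (λ ()) (λ ()) (λ ()) (λ ())
partite-finite (x ∷ m) =
  ↔-trans split (↔-trans (↔-refl ⊎-↔ partite-finite m) (↔-sym +↔⊎))
  where
  split : PartiteVertex (x ∷ m) ↔ (Fin x ⊎ PartiteVertex m)
  split = mk↔ₛ′
    (λ { (zero , j) → inj₁ j ; (suc i , j) → inj₂ (i , j) })
    (λ { (inj₁ j) → zero , j ; (inj₂ (i , j)) → suc i , j })
    (λ { (inj₁ _) → refl ; (inj₂ _) → refl })
    (λ { (zero , _) → refl ; (suc _ , _) → refl })

-- The i-th entry of m is the number of vertices in the i-th partite set.
completeMultipartite : ∀ {k} → Vec ℕ k → Graph
completeMultipartite m = record
  { Vertex     = PartiteVertex m
  ; order      = sum m
  ; finite     = partite-finite m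
  ; Adj        = λ u v → proj₁ u ≢ proj₁ v
  ; adj?       = λ u v → ¬? (proj₁ u Fin.≟ proj₁ v)
  ; sym-adj    = λ u≢v → u≢v ∘ sym
  ; irrefl-adj = λ u≡v u≢v → u≢v (cong proj₁ u≡v)
  }

{-# OPTIONS --safe #-}
-- Colour the parts one after another with consecutive integers, skipping r = max T
-- colours after each part: vertices in different parts then differ by more than r,
-- hence by no element of T.
module Submission where

open import Defs
open import Data.Fin using (zero; suc; toℕ)
open import Data.Fin.Properties using (toℕ<n; toℕ-injective)
open import Data.List using (List)
open import Data.List.Extrema.Nat using (max; xs≤max)
open import Data.List.Membership.Propositional using (_∈_)
import Data.List.Relation.Unary.All as List
open import Data.Nat using (ℕ; _+_; _*_; _∸_; _≤_; _<_; ∣_-_∣)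
open import Data.Nat.Properties
open import Data.Nat.Solver using (module +-*-Solver)
open import Data.Product using (_,_; proj₁; proj₂)
open import Data.Vec using (Vec; _∷_; sum)
open import Data.Vec.Relation.Unary.All using (All)
open import Function using (_∘_)
open import Relation.Binary.PropositionalEquality
open import Relation.Nullary using (contradiction)

-- The span is a minimum over colourings, so one colouring with small colours suffices. Each part of
-- size x uses up x colours and r skipped ones, so all k parts fit below `r * k + sum m`
-- (`colour<`). The gaps settle adjacent vertices (`colour-separated`). All colours are distinct
-- (`colour-injective`), which settles vertices at distance 2.

module _ (r : ℕ) where

  colour : ∀ {k} (m : Vec ℕ k) → PartiteVertex m → ℕ
  colour (x ∷ m) (zero , j) = toℕ j
  colour (x ∷ m) (suc i , j) = (x + r) + colour m (i , j)

  -- The gap after the last part is counted too, hence `r * k` rather than r times k - 1.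
  colour< : ∀ {k} (m : Vec ℕ k) v → colour m v < r * k + sum m
  colour< {k} (x ∷ m) (zero , j) =
    <-≤-trans (toℕ<n j) (≤-trans (m≤m+n x (sum m)) (m≤n+m (x + sum m) (r * k)))
  colour< {ℕ.suc k} (x ∷ m) (suc i , j) = begin-strict
    (x + r) + colour m (i , j)     <⟨ +-monoʳ-< (x + r) (colour< m (i , j)) ⟩
    (x + r) + (r * k + sum m)      ≡⟨ rearrange x r k (sum m) ⟩
    r * ℕ.suc k + (x + sum m)      ∎
    where
    open ≤-Reasoning
    open +-*-Solver
    rearrange : ∀ x r k s → (x + r) + (r * k + s) ≡ r * ℕ.suc k + (x + s)
    rearrange = solve 4 (λ x r k s →
      (x :+ r) :+ (r :* k :+ s) := r :* (con 1 :+ k) :+ (x :+ s)) refl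

  r<gap : ∀ {j x} c → j < x → r < ∣ j - (x + r) + c ∣
  -- Adding `j` to both sides lets the triangle inequality replace a case split on the absolute
  -- value.
  r<gap {j} {x} c j<x = +-cancelˡ-< j _ _ (begin-strict
    j + r                       <⟨ +-monoˡ-< r j<x ⟩
    x + r                       ≤⟨ m≤m+n (x + r) c ⟩
    (x + r) + c                 ≤⟨ m≤n+∣n-m∣ ((x + r) + c) j ⟩
    j + ∣ j - (x + r) + c ∣     ∎)
    where open ≤-Reasoning

  -- If one vertex lies in the first part, `r<gap` applies; otherwise both colours carry the same
  -- shift `x + r`, which cancels.
  colour-separated : ∀ {k} (m : Vec ℕ k) u v → proj₁ u ≢ proj₁ v →
                     r < ∣ colour m u - colour m v ∣
  colour-separated (x ∷ m) (zero , _) (zero , _) i≢i = contradiction refl i≢i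
  colour-separated (x ∷ m) (zero , j) (suc i , l) _ = r<gap (colour m (i , l)) (toℕ<n j)
  colour-separated (x ∷ m) (suc i , l) (zero , j) _ =
    subst (r <_) (∣-∣-comm (toℕ j) _) (r<gap (colour m (i , l)) (toℕ<n j))
  colour-separated (x ∷ m) (suc i , j) (suc i′ , j′) i≢i′ =
    subst (r <_) (sym (∣m+n-m+o∣≡∣n-o∣ (x + r) _ _))
      (colour-separated m (i , j) (i′ , j′) (i≢i′ ∘ cong suc))

  -- Equal colours in different parts would put the difference 0 above `r`; within a part, colours
  -- are shifted positions.
  colour-injective : ∀ {k} (m : Vec ℕ k) u v → colour m u ≡ colour m v → u ≡ v
  colour-injective (x ∷ m) (zero , j) (zero , j′) e = cong (zero ,_) (toℕ-injective e)
  colour-injective (x ∷ m) u@(zero , _) v@(suc _ , _) e =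
    contradiction (subst (r <_) (m≡n⇒∣m-n∣≡0 e) (colour-separated (x ∷ m) u v λ ())) n≮0
  colour-injective (x ∷ m) u@(suc _ , _) v@(zero , _) e =
    contradiction (subst (r <_) (m≡n⇒∣m-n∣≡0 e) (colour-separated (x ∷ m) u v λ ())) n≮0
  colour-injective (x ∷ m) (suc i , j) (suc i′ , j′) e
    with refl ← colour-injective m (i , j) (i′ , j′) (+-cancelˡ-≡ (x + r) _ _ e) = refl

module _ {k} (m : Vec ℕ k) where
  open Graph (completeMultipartite m)

  distance1⇒adjacent : ∀ {u v} → Distance u v 1 → Adj u v
  distance1⇒adjacent (a ∷ [] , _) = a

  colour-isColouring : ∀ T → IsColouring T (completeMultipartite m) (colour (max 0 T) m)
  colour-isColouring T u v =
    (λ d diff∈T → <⇒≱ (colour-separated r m u v (distance1⇒adjacent d))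
                      (List.lookup (xs≤max 0 T) diff∈T)) ,
    (λ d → distance⇒≢ (completeMultipartite m) d ∘ colour-injective r m u v)
    where
    r : ℕ
    r = max 0 T

theorem2p4 : (T : List ℕ) → 0 ∈ T →
    (k : ℕ) → 1 ≤ k → (m : Vec ℕ k) → All (1 ≤_) m →
    span T (completeMultipartite m) ≤ max 0 T * k + sum m ∸ 1
theorem2p4 T _ k _ m _ =
  ≤-trans (minimal c (colour-isColouring m T))
    -- A difference of colours is at most the larger colour; the strict bound `colour<` yields the
    -- final `∸ 1`.
    (spread≤ T G c λ u v → ≤-trans (∣m-n∣≤m⊔n (c u) (c v))
      (⊔-lub (<⇒≤pred (colour< r m u)) (<⇒≤pred (colour< r m v))))
  where
  r = max 0 T
  G = completeMultipartite m
  c = colour r m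
  minimal = proj₂ (span-isSpan T G)
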